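{- Let $p$ be a prime and suppose $E\subset\mathbb{F}_p^3$ $1$-tiles $\mathbb{F}_p^3$ by $A\subset\mathbb{F}_p^3$. Then the tiling $(E,A)$ is graphical, i.e., either $E$ or $A$ is a graph. More generally, if $d\ge1$ and $(E,A)$ is a tiling pair in $\mathbb{F}_p^d$ (i.e., $E$ $1$-tiles $\mathbb{F}_p^d$ by $A$) with $|E|=p$ or $|E|=p^{d-1}$, then either $E$ or $A$ is a graph.
   Context: $E$ $1$-tiles $\mathbb{F}_p^d$ by $A$ means $\sum_{a\in A}1_E(x-a)=1$ for every $x\in\mathbb{F}_p^d$. A set $E\subset\mathbb{F}_p^d$ is a graph if there exist an integer $0\le s\le d$, a basis $e_1,\dots,e_d$ of $\mathbb{F}_p^d$ and a function $f=(f_1,\dots,f_{d-s}):\mathbb{F}_p^s\to\mathbb{F}_p^{d-s}$ such that $E=\{\sum_{i=1}^s x_ie_i+\sum_{j=1}^{d-s}f_j(x)e_{s+j}: x\in\mathbb{F}_p^s\}$. -}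

module Defs where

open import Data.Nat using (ℕ; zero; suc; _+_; _*_; NonZero)
open import Data.Nat.DivMod using (_mod_)
open import Data.Fin using (Fin; toℕ)
open import Data.Vec using (Vec; []; _∷_; _++_; lookup; tabulate; replicate; zipWith)
open import Data.List using (List; []; _∷_; length; filter; concatMap; map; allFin; foldr)
open import Data.Bool using (Bool; true; _∧_; T)
open import Data.Product using (Σ; ∃; _×_; _,_)
open import Relation.Binary.PropositionalEquality using (_≡_; subst)
open import Function.Bundles using (_⇔_)
open import Relation.Nullary.Decidable using (T?)

F : ℕ → Set
F p = Fin p

module Field (p : ℕ) .{{_ : NonZero p}} where
  _+F_ : F p → F p → F p
  a +F b = (toℕ a + toℕ b) mod p

  _*F_ : F p → F p → F p
  a *F b = (toℕ a * toℕ b) mod p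

  0F : F p
  0F = 0 mod p

  -F_ : F p → F p
  -F a = (p Data.Nat.∸ toℕ a) mod p

  V : ℕ → Set
  V d = Vec (F p) d

  _+V_ : ∀ {d} → V d → V d → V d
  _+V_ = zipWith _+F_

  _-V_ : ∀ {d} → V d → V d → V d
  x -V y = zipWith (λ a b → a +F (-F b)) x y

  _·V_ : ∀ {d} → F p → V d → V d
  c ·V x = Data.Vec.map (c *F_) x

  0V : ∀ {d} → V d
  0V = replicate _ 0F

  lincomb : ∀ {n d} → Vec (F p) n → (Fin n → V d) → V d
  lincomb {n} c e = foldr (λ i acc → (lookup c i ·V e i) +V acc) 0V (allFin n)

  IsBasis : ∀ {d} → (Fin d → V d) → Set
  IsBasis {d} e =
    (∀ (c : Vec (F p) d) → lincomb c e ≡ 0V → c ≡ replicate d 0F)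
    × (∀ (y : V d) → ∃ λ (c : Vec (F p) d) → lincomb c e ≡ y)

  Subset : ℕ → Set
  Subset d = V d → Bool

  _∈_ : ∀ {d} → V d → Subset d → Set
  x ∈ E = T (E x)

  allVecs : (n : ℕ) → List (Vec (F p) n)
  allVecs zero = [] ∷ []
  allVecs (suc n) = concatMap (λ a → map (a ∷_) (allVecs n)) (allFin p)

  card : ∀ {d} → Subset d → ℕ
  card {d} E = length (filter (λ x → T? (E x)) (allVecs d))

  -- E 1-tiles F_p^d by A: Σ_{a∈A} 1_E(x-a) = 1 for every x.
  Tiles : ∀ {d} → Subset d → Subset d → Set
  Tiles {d} E A = ∀ (x : V d) → card (λ a → A a ∧ E (x -V a)) ≡ 1

  -- E is a graph: there are s (and t = d - s, with s + t = d), a basis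
  -- e_1..e_d and f : F_p^s → F_p^t with
  -- E = { Σ_{i≤s} x_i e_i + Σ_{j≤t} f_j(x) e_{s+j} : x ∈ F_p^s }.
  IsGraph : ∀ {d} → Subset d → Set
  IsGraph {d} E =
    Σ ℕ λ s → Σ ℕ λ t → Σ (s + t ≡ d) λ st →
    Σ (Fin d → V d) λ e → IsBasis e ×
    Σ (Vec (F p) s → Vec (F p) t) λ f →
      ∀ (y : V d) → (y ∈ E) ⇔
        (∃ λ (x : Vec (F p) s) → lincomb (subst (Vec (F p)) st (x ++ f x)) e ≡ y)

{-# OPTIONS --safe #-}

-- Suppose |E| = p (otherwise exchange E and A).  For a prime q ≠ p the Frobenius map of the group
-- ring modulo q turns the tiling E ⊕ A into a tiling qE ⊕ A; factoring k < p into primes, kE ⊕ A is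
-- a tiling for every k not divisible by p.  Hence E - E and A - A have no common direction: for
-- e ≠ e′ in E, every line parallel to e - e′ meets A at most once, and, as |A| = p^(d-1), exactly
-- once.  So A is a graph over a coordinate hyperplane transversal to e - e′.  In dimension 3 the
-- only other case is |E| = 1 or |A| = 1, and singletons are graphs with s = 0.
module Submission where

open import Defs
open import Algebra.Bundles using (CommutativeRing; Semiring)
open import Data.Bool using (Bool; true; false; _∧_; T)
open import Data.Bool.Properties using (T-≡; ∧-comm)
open import Data.Empty using (⊥; ⊥-elim)
open import Data.Fin using (Fin; zero; suc; toℕ; fromℕ; inject₁)
open import Data.Fin.Properties using (toℕ<n; toℕ-fromℕ; toℕ-fromℕ<; toℕ-inject₁; toℕ-injective; fromℕ<-cong; _≟_)
open import Data.List as List using (List; []; _∷_; map; filter; length; foldr; allFin; concatMap; cartesianProductWith)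
open import Data.List.Properties using (map-++; map-∘; map-cong; map-id; map-tabulate; length-map; length-tabulate)
open import Data.List.Membership.Propositional using () renaming (_∈_ to _∈ˡ_)
open import Data.List.Membership.Propositional.Properties using (∈-map⁺; ∈-allFin; ∈-filter⁺; ∈-filter⁻; ∈-cartesianProductWith⁺)
open import Data.List.Membership.Propositional.Properties.WithK using (unique∧set⇒bag)
open import Data.List.Relation.Binary.BagAndSetEquality using (∼bag⇒↭)
import Data.List.Relation.Binary.Permutation.Propositional.Properties as Perm
open import Data.List.Relation.Unary.All as All using (All; []; _∷_)
open import Data.List.Relation.Unary.AllPairs using ([]; _∷_)
open import Data.List.Relation.Unary.Any using (here; there)
open import Data.List.Relation.Unary.Unique.Propositional using (Unique)
open import Data.List.Relation.Unary.Unique.Propositional.Properties using (map⁺; allFin⁺; filter⁺; cartesianProductWith⁺)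
open import Data.Nat as ℕ using (ℕ; zero; suc; _≤_; _<_; _≥_; s≤s; z≤n; s<s; NonZero; _^_; _∸_; _%_)
import Data.Nat.Properties as ℕ
open import Data.Nat.Combinatorics using (_C_; nCn≡1; nC1≡n; nCk+nC[k+1]≡[n+1]C[k+1])
open import Data.Nat.Coprimality using (prime⇒coprime; coprime-Bézout)
open import Data.Nat.Divisibility using (_∣_; divides; m∣m*n; ∣⇒≤; ∣1⇒≡1)
open import Data.Nat.DivMod using (_mod_; m%n<n; n%n≡0; %-distribˡ-+; %-distribˡ-*; m<n⇒m%n≡m; [m+kn]%n≡m%n)
open import Data.Nat.GCD using (module Bézout)
open import Data.Nat.ListAction using (sum; product)
open import Data.Nat.ListAction.Properties using (sum-++; sum-↭; ∈⇒∣product)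
open import Data.Nat.Primality using (Prime; prime⇒nonZero; prime⇒nonTrivial; prime⇒irreducible; euclidsLemma; ¬prime[1])
open import Data.Nat.Primality.Factorisation using (factorise; PrimeFactorisation)
open import Data.Nat.Tactic.RingSolver using (solve-∀)
open import Data.Product using (∃; ∃₂; _,_; _×_; proj₁; proj₂)
open import Data.Sum using (_⊎_; inj₁; inj₂)
open import Data.Vec using ([]; _∷_; _++_; lookup; insertAt; removeAt; take; drop; head)
open import Data.Vec.Properties using (∷-injective; lookup-zipWith; lookup-map; insertAt-lookup; removeAt-insertAt; insertAt-removeAt; take-zipWith; drop-zipWith; take-map; drop-map; take++drop≡id)
open import Function using (_∘_; id; mk⇔; _⇔_; Equivalence)
open import Relation.Binary.PropositionalEquality as ≡ using (_≡_; _≢_; _≗_; refl; sym; trans; cong; cong₂; subst; module ≡-Reasoning)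
open import Relation.Nullary using (¬_; yes; no)
open import Relation.Nullary.Decidable using (T?; decidable-stable)

-- Freshman's dream

-- The group ring is modelled by the semiring of additive operators on ℕ-valued functions: E acts by
-- convolution on the indicator of A, and a congruence modulo q is an equality with an explicit
-- summand `q ×ᵒ z`, so everything stays in ℕ. Frobenius gives information only modulo q, while a
-- tiling is an exact statement. A count bridges the gap: a value that is nonzero modulo q at every
-- point means that every point is covered, and the total mass |E||A| = p^d leaves no room for a
-- second cover. The size |E| = p enters twice. A prime q dividing some k < p does not divide |E|,
-- so |E|^(q-1) is nonzero modulo q; and |A| = p^(d-1) is the number of lines in a given direction.
-- A common direction a - a′ = k(e - e′) is impossible because a + ke′ = a′ + ke would be covered
-- twice by kE ⊕ A. The scalar k is arbitrary here, which is why prime dilations have to be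
-- composed.

[1+k]*[1+n]C[1+k]≡[1+n]*nCk : ∀ n k → suc k ℕ.* (suc n C suc k) ≡ suc n ℕ.* (n C k)
[1+k]*[1+n]C[1+k]≡[1+n]*nCk zero    zero    = refl
[1+k]*[1+n]C[1+k]≡[1+n]*nCk zero    (suc k) = ℕ.*-zeroʳ (suc (suc k))
[1+k]*[1+n]C[1+k]≡[1+n]*nCk (suc n) zero    = begin
  1 ℕ.* (suc (suc n) C 1)  ≡⟨ ℕ.*-identityˡ _ ⟩
  suc (suc n) C 1          ≡⟨ nC1≡n (suc (suc n)) ⟩
  suc (suc n)              ≡⟨ ℕ.*-identityʳ _ ⟨
  suc (suc n) ℕ.* 1        ∎
  where open ≡-Reasoning
[1+k]*[1+n]C[1+k]≡[1+n]*nCk (suc n) (suc k) = begin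
  suc (suc k) ℕ.* (suc (suc n) C suc (suc k))
    ≡⟨ cong (suc (suc k) ℕ.*_) (nCk+nC[k+1]≡[n+1]C[k+1] (suc n) (suc k)) ⟨
  suc (suc k) ℕ.* (a ℕ.+ b)
    ≡⟨ expand k a b ⟩
  a ℕ.+ (suc k ℕ.* a ℕ.+ suc (suc k) ℕ.* b)
    ≡⟨ cong (a ℕ.+_) (cong₂ ℕ._+_ ([1+k]*[1+n]C[1+k]≡[1+n]*nCk n k) ([1+k]*[1+n]C[1+k]≡[1+n]*nCk n (suc k))) ⟩
  a ℕ.+ (suc n ℕ.* (n C k) ℕ.+ suc n ℕ.* (n C suc k))
    ≡⟨ cong (a ℕ.+_) (ℕ.*-distribˡ-+ (suc n) (n C k) (n C suc k)) ⟨
  a ℕ.+ suc n ℕ.* (n C k ℕ.+ n C suc k)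
    ≡⟨ cong (λ c → a ℕ.+ suc n ℕ.* c) (nCk+nC[k+1]≡[n+1]C[k+1] n k) ⟩
  suc (suc n) ℕ.* a ∎
  where
  open ≡-Reasoning
  a = suc n C suc k
  b = suc n C suc (suc k)
  expand : ∀ k a b → suc (suc k) ℕ.* (a ℕ.+ b) ≡ a ℕ.+ (suc k ℕ.* a ℕ.+ suc (suc k) ℕ.* b)
  expand = solve-∀

-- By the absorption identity the prime divides (1+k) times the binomial coefficient, and it cannot
-- divide 1+k, which is positive and smaller.
prime∣[1+n]C[1+k] : ∀ {n k} → Prime (suc n) → k < n → suc n ∣ (suc n C suc k)
prime∣[1+n]C[1+k] {n} {k} pr k<n
  with euclidsLemma (suc k) (suc n C suc k) pr
         (≡.subst (suc n ∣_) (≡.sym ([1+k]*[1+n]C[1+k]≡[1+n]*nCk n k)) (m∣m*n (n C k)))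
... | inj₂ q∣C = q∣C
... | inj₁ q∣k = ⊥-elim (ℕ.<⇒≱ (s<s k<n) (∣⇒≤ q∣k))

module Frobenius {a ℓ} (S : Semiring a ℓ) where
  open Semiring S hiding (zero; refl) renaming (trans to ≈-trans; sym to ≈-sym)
  open import Algebra.Properties.Semiring.Sum S using (sum-init-last) renaming (sum to ∑ᵒ)
  open import Algebra.Properties.Semiring.Mult S using (×-assoc-*; ×-congʳ; ×-assocˡ; ×-homo-1) renaming (_×_ to _×ᵒ_)
  open import Algebra.Properties.Semiring.Exp S using () renaming (_^_ to _^ᵒ_)
  open import Algebra.Properties.CommutativeMonoid.Mult +-commutativeMonoid using (×-distrib-+)
  import Algebra.Properties.Semiring.Binomial S as Binomial
  open import Relation.Binary.Reasoning.Setoid setoid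

  sum-multiple : ∀ q n (t : Fin n → Carrier) → (∀ i → ∃ λ z → t i ≈ q ×ᵒ z) → ∃ λ z → ∑ᵒ t ≈ q ×ᵒ z
  sum-multiple q zero    t m = 0# , (begin
    0#              ≈⟨ zeroʳ (q ×ᵒ 1#) ⟨
    (q ×ᵒ 1#) * 0#  ≈⟨ ×-assoc-* q 1# 0# ⟩
    q ×ᵒ (1# * 0#)  ≈⟨ ×-congʳ q (*-identityˡ 0#) ⟩
    q ×ᵒ 0#         ∎)
  sum-multiple q (suc n) t m with m zero | sum-multiple q n (λ i → t (suc i)) (λ i → m (suc i))
  ... | y , eq | z , eqs = y + z , ≈-trans (+-cong eq eqs) (≈-sym (×-distrib-+ y z q))

  -- The binomial theorem holds for a commuting pair in any semiring, and all its inner coefficients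
  -- are divisible by q. The error term is an explicit multiple of q because a semiring has no
  -- subtraction in which to state a congruence.
  freshman's-dream : ∀ {q} → Prime q → ∀ x y → x * y ≈ y * x → ∃ λ z → (x + y) ^ᵒ q ≈ (x ^ᵒ q + y ^ᵒ q) + q ×ᵒ z
  freshman's-dream {zero}  pr x y xy with () ← prime⇒nonZero pr
  freshman's-dream {suc n} pr x y xy = z , (begin
    (x + y) ^ᵒ suc n                              ≈⟨ theorem xy (suc n) ⟩
    t zero + ∑ᵒ (λ i → t (suc i))                 ≈⟨ +-cong first (sum-init-last (λ i → t (suc i))) ⟩
    y ^ᵒ suc n + (∑ᵒ middle + t (suc (fromℕ n)))  ≈⟨ +-congˡ (+-cong middle≈ last) ⟩
    y ^ᵒ suc n + (suc n ×ᵒ z + x ^ᵒ suc n)        ≈⟨ +-congˡ (+-comm _ _) ⟩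
    y ^ᵒ suc n + (x ^ᵒ suc n + suc n ×ᵒ z)        ≈⟨ +-assoc _ _ _ ⟨
    (y ^ᵒ suc n + x ^ᵒ suc n) + suc n ×ᵒ z        ≈⟨ +-congʳ (+-comm _ _) ⟩
    (x ^ᵒ suc n + y ^ᵒ suc n) + suc n ×ᵒ z        ∎)
    where
    open Binomial x y
    t = binomialTerm (suc n)

    -- With q = suc n, the binomial indices 0 and q are split off; these are the indices 1 to q - 1.
    middle : Fin n → Carrier
    middle i = t (suc (inject₁ i))

    multiple : ∀ i → ∃ λ z → middle i ≈ suc n ×ᵒ z
    multiple i with prime∣[1+n]C[1+k] {n} {toℕ (inject₁ i)} pr (≡.subst (_< n) (≡.sym (toℕ-inject₁ i)) (toℕ<n i))
    ... | divides c eq = c ×ᵒ b , (begin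
      (suc n C suc (toℕ (inject₁ i))) ×ᵒ b  ≡⟨ cong (_×ᵒ b) (≡.trans eq (ℕ.*-comm c (suc n))) ⟩
      (suc n ℕ.* c) ×ᵒ b                    ≈⟨ ×-assocˡ b (suc n) c ⟨
      suc n ×ᵒ (c ×ᵒ b)                     ∎)
      where b = binomial (suc n) (suc (inject₁ i))

    middle-sum = sum-multiple (suc n) n middle multiple
    z = proj₁ middle-sum
    middle≈ = proj₂ middle-sum

    first : t zero ≈ y ^ᵒ suc n
    first = ≈-trans (×-homo-1 _) (*-identityˡ _)

    last : t (suc (fromℕ n)) ≈ x ^ᵒ suc n
    last rewrite toℕ-fromℕ n | nCn≡1 (suc n) | ℕ.n∸n≡0 n = ≈-trans (×-homo-1 _) (*-identityʳ _)

-- Finite sums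

ind : Bool → ℕ
ind true  = 1
ind false = 0

module _ {X : Set} where

  ∑ : List X → (X → ℕ) → ℕ
  ∑ xs g = sum (map g xs)

  ∑-cong : ∀ xs {g h : X → ℕ} → g ≗ h → ∑ xs g ≡ ∑ xs h
  ∑-cong []       eq = refl
  ∑-cong (x ∷ xs) eq = cong₂ ℕ._+_ (eq x) (∑-cong xs eq)

  ∑-+ : ∀ xs (g h : X → ℕ) → ∑ xs (λ x → g x ℕ.+ h x) ≡ ∑ xs g ℕ.+ ∑ xs h
  ∑-+ []       g h = refl
  ∑-+ (x ∷ xs) g h = trans (cong (g x ℕ.+ h x ℕ.+_) (∑-+ xs g h)) (interchange (g x) (h x) _ _)
    where open import Algebra.Properties.CommutativeSemigroup ℕ.+-commutativeSemigroup using (interchange)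

  ∑-const : ∀ (xs : List X) c → ∑ xs (λ _ → c) ≡ length xs ℕ.* c
  ∑-const []       c = refl
  ∑-const (x ∷ xs) c = cong (c ℕ.+_) (∑-const xs c)

  ∑-filter : ∀ (E : X → Bool) xs g → ∑ (filter (λ x → T? (E x)) xs) g ≡ ∑ xs (λ x → ind (E x) ℕ.* g x)
  ∑-filter E []       g = refl
  ∑-filter E (x ∷ xs) g with E x
  ... | true  = cong₂ ℕ._+_ (sym (ℕ.+-identityʳ (g x))) (∑-filter E xs g)
  ... | false = ∑-filter E xs g

  length-filter : ∀ (E : X → Bool) xs → length (filter (λ x → T? (E x)) xs) ≡ ∑ xs (ind ∘ E)
  length-filter E []       = refl
  length-filter E (x ∷ xs) with E x
  ... | true  = cong suc (length-filter E xs)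
  ... | false = length-filter E xs

  term≤∑ : ∀ {x xs} (g : X → ℕ) → x ∈ˡ xs → g x ≤ ∑ xs g
  term≤∑ g (here refl) = ℕ.m≤m+n _ _
  term≤∑ g (there x∈)  = ℕ.≤-trans (term≤∑ g x∈) (ℕ.m≤n+m _ _)

  two-terms≤∑ : ∀ {x y xs} (g : X → ℕ) → x ≢ y → x ∈ˡ xs → y ∈ˡ xs → g x ℕ.+ g y ≤ ∑ xs g
  two-terms≤∑ g x≢y (here refl) (here refl) = ⊥-elim (x≢y refl)
  two-terms≤∑ g x≢y (here refl) (there y∈)  = ℕ.+-monoʳ-≤ _ (term≤∑ g y∈)
  two-terms≤∑ {x} {y} g x≢y (there x∈) (here refl) =
    ℕ.≤-trans (ℕ.≤-reflexive (ℕ.+-comm (g x) (g y))) (ℕ.+-monoʳ-≤ _ (term≤∑ g x∈))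
  two-terms≤∑ g x≢y (there x∈)  (there y∈)  = ℕ.≤-trans (two-terms≤∑ g x≢y x∈ y∈) (ℕ.m≤n+m _ _)

  ∑-mono : ∀ xs {g h : X → ℕ} → (∀ x → g x ≤ h x) → ∑ xs g ≤ ∑ xs h
  ∑-mono []       le = z≤n
  ∑-mono (x ∷ xs) le = ℕ.+-mono-≤ (le x) (∑-mono xs le)

  -- This turns one-sided bounds into exact counts: "at least one cover" for dilated tilings and "at
  -- most one point" for lines, each combined with a known total.
  ∑-tight : ∀ {xs} {g h : X → ℕ} → (∀ x → g x ≤ h x) → ∑ xs g ≡ ∑ xs h → ∀ {x} → x ∈ˡ xs → g x ≡ h x
  ∑-tight {y ∷ xs} {g} {h} le eq x∈ = go x∈
    where
    tail≤ : ∑ xs g ≤ ∑ xs h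
    tail≤ = ∑-mono xs le

    head≡ : g y ≡ h y
    head≡ = ℕ.≤-antisym (le y)
      (ℕ.+-cancelʳ-≤ (∑ xs g) _ _ (ℕ.≤-trans (ℕ.+-monoʳ-≤ (h y) tail≤) (ℕ.≤-reflexive (sym eq))))

    tail≡ : ∑ xs g ≡ ∑ xs h
    tail≡ = ℕ.+-cancelˡ-≡ (h y) _ _ (trans (cong (ℕ._+ ∑ xs g) (sym head≡)) eq)

    go : ∀ {x} → x ∈ˡ y ∷ xs → g x ≡ h x
    go (here refl) = head≡
    go (there x∈)  = ∑-tight le tail≡ x∈

  -- The list and its image under `φ` are both duplicate-free and both contain everything, so they
  -- are permutations of each other.
  ∑-bijection : ∀ {xs} → Unique xs → (∀ x → x ∈ˡ xs) → (φ ψ : X → X) → ψ ∘ φ ≗ id → φ ∘ ψ ≗ id →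
                ∀ g → ∑ xs (g ∘ φ) ≡ ∑ xs g
  ∑-bijection {xs} uniq all φ ψ ψφ φψ g = trans (cong sum (map-∘ xs)) (sum-↭ (Perm.map⁺ g perm))
    where
    perm = ∼bag⇒↭ (unique∧set⇒bag
      (map⁺ (λ {x} {y} eq → trans (sym (ψφ x)) (trans (cong ψ eq) (ψφ y))) uniq) uniq
      (λ {x} → mk⇔ (λ _ → all x) (λ _ → subst (_∈ˡ map φ xs) (φψ x) (∈-map⁺ φ (all (ψ x))))))

∑-swap : ∀ {X Y : Set} (xs : List X) (ys : List Y) (g : X → Y → ℕ) →
         ∑ xs (λ x → ∑ ys (g x)) ≡ ∑ ys (λ y → ∑ xs (λ x → g x y))
∑-swap []       ys g = sym (trans (∑-const ys 0) (ℕ.*-zeroʳ (length ys)))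
∑-swap (x ∷ xs) ys g = trans (cong (∑ ys (g x) ℕ.+_) (∑-swap xs ys g)) (sym (∑-+ ys _ _))

∑-map : ∀ {X Y : Set} (f : X → Y) xs (g : Y → ℕ) → ∑ (map f xs) g ≡ ∑ xs (g ∘ f)
∑-map f xs g = cong sum (sym (map-∘ xs))

∑-concatMap : ∀ {X Y : Set} (f : X → List Y) xs (g : Y → ℕ) → ∑ (concatMap f xs) g ≡ ∑ xs (λ x → ∑ (f x) g)
∑-concatMap f []       g = refl
∑-concatMap f (x ∷ xs) g = begin
  sum (map g (f x List.++ concatMap f xs))          ≡⟨ cong sum (map-++ g (f x) _) ⟩
  sum (map g (f x) List.++ map g (concatMap f xs))  ≡⟨ sum-++ (map g (f x)) _ ⟩
  ∑ (f x) g ℕ.+ ∑ (concatMap f xs) g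
    ≡⟨ cong (∑ (f x) g ℕ.+_) (∑-concatMap f xs g) ⟩
  ∑ (f x) g ℕ.+ ∑ xs (λ x → ∑ (f x) g)                       ∎
  where open ≡-Reasoning

-- The semiring of additive operators

module Operators (X : Set) where

  -- Multiplication will be composition. Additivity then gives left distributivity and `ap-0` the
  -- right zero law; `ap-cong` is a field because functions are compared pointwise.
  record Op : Set where
    field
      ap     : (X → ℕ) → X → ℕ
      ap-cong : ∀ {g h} → g ≗ h → ap g ≗ ap h
      ap-+   : ∀ g h → ap (λ x → g x ℕ.+ h x) ≗ λ x → ap g x ℕ.+ ap h x
      ap-0   : ap (λ _ → 0) ≗ λ _ → 0
  open Op public

  opSemiring : Semiring _ _
  opSemiring = record
    { Carrier = Op
    ; _≈_ = λ S T → ∀ g → ap S g ≗ ap T g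
    ; _+_ = λ S T → record
      { ap = λ g x → ap S g x ℕ.+ ap T g x
      ; ap-cong = λ eq x → cong₂ ℕ._+_ (ap-cong S eq x) (ap-cong T eq x)
      ; ap-+ = λ g h x → trans (cong₂ ℕ._+_ (ap-+ S g h x) (ap-+ T g h x)) (interchange (ap S g x) _ _ _)
      ; ap-0 = λ x → cong₂ ℕ._+_ (ap-0 S x) (ap-0 T x) }
    ; _*_ = λ S T → record
      { ap = ap S ∘ ap T
      ; ap-cong = ap-cong S ∘ ap-cong T
      ; ap-+ = λ g h x → trans (ap-cong S (ap-+ T g h) x) (ap-+ S _ _ x)
      ; ap-0 = λ x → trans (ap-cong S (ap-0 T) x) (ap-0 S x) }
    ; 0# = record { ap = λ _ _ → 0 ; ap-cong = λ _ _ → refl ; ap-+ = λ _ _ _ → refl ; ap-0 = λ _ → refl }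
    ; 1# = record { ap = id ; ap-cong = id ; ap-+ = λ _ _ _ → refl ; ap-0 = λ _ → refl }
    ; isSemiring = record
      { isSemiringWithoutAnnihilatingZero = record
        { +-isCommutativeMonoid = record
          { isMonoid = record
            { isSemigroup = record
              { isMagma = record
                { isEquivalence = record
                  { refl = λ _ _ → refl
                  ; sym = λ p g x → sym (p g x)
                  ; trans = λ p q g x → trans (p g x) (q g x) }
                ; ∙-cong = λ p q g x → cong₂ ℕ._+_ (p g x) (q g x) }
              ; assoc = λ S T U g x → ℕ.+-assoc (ap S g x) _ _ }
            ; identity = (λ _ _ _ → refl) , (λ _ _ _ → ℕ.+-identityʳ _) }
          ; comm = λ S T g x → ℕ.+-comm (ap S g x) _ }
        ; *-cong = λ {S} {S′} {T} {T′} p q g x → trans (ap-cong S (q g) x) (p (ap T′ g) x)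
        ; *-assoc = λ _ _ _ _ _ → refl
        ; *-identity = (λ _ _ _ → refl) , (λ _ _ _ → refl)
        ; distrib = (λ S T U g x → ap-+ S _ _ x) , (λ _ _ _ _ _ → refl) }
      ; zero = (λ _ _ _ → refl) , (λ S g x → ap-0 S x) } }
    where open import Algebra.Properties.CommutativeSemigroup ℕ.+-commutativeSemigroup using (interchange)

-- Indicator sums

ind-∧ : ∀ a b → ind (a ∧ b) ≡ ind a ℕ.* ind b
ind-∧ true  b = sym (ℕ.+-identityʳ (ind b))
ind-∧ false b = refl

ind≡1 : ∀ {b} → T b → ind b ≡ 1
ind≡1 {true} _ = refl

∑-ind>0 : ∀ {X : Set} xs (A : X → Bool) → 0 < ∑ xs (ind ∘ A) → ∃ λ x → T (A x)
∑-ind>0 (x ∷ xs) A pos with A x in eq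
... | true  = x , Equivalence.from T-≡ eq
... | false = ∑-ind>0 xs A pos

∑-ind≤1 : ∀ {X : Set} {xs} (A : X → Bool) → Unique xs → (∀ {x y} → x ≢ y → T (A x) → T (A y) → ⊥) → ∑ xs (ind ∘ A) ≤ 1
∑-ind≤1 {xs = []}     A _           _    = z≤n
∑-ind≤1 {xs = x ∷ xs} A (x∉ ∷ uniq) once with A x in eq
... | false = ∑-ind≤1 A uniq once
... | true  = s≤s (ℕ.≤-reflexive (none xs x∉))
  where
  none : ∀ ys → All (x ≢_) ys → ∑ ys (ind ∘ A) ≡ 0
  none []       _          = refl
  none (y ∷ ys) (x≢y ∷ ≢s) with A y in eq′
  ... | true  = ⊥-elim (once x≢y (Equivalence.from T-≡ eq) (Equivalence.from T-≡ eq′))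
  ... | false = none ys ≢s

-- Linear algebra over the prime field

module PrimeField (p : ℕ) (pr : Prime p) where
  instance
    p≢0 : NonZero p
    p≢0 = prime⇒nonZero pr
  open Field p {{prime⇒nonZero pr}}

  ι : ℕ → F p
  ι n = n mod p

  toℕ-ι : ∀ n → toℕ (ι n) ≡ n % p
  toℕ-ι n = toℕ-fromℕ< (m%n<n n p)

  ι-cong-% : ∀ {m n} → m % p ≡ n % p → ι m ≡ ι n
  ι-cong-% {m} {n} eq = fromℕ<-cong _ _ eq _ _

  ι-toℕ : ∀ a → ι (toℕ a) ≡ a
  ι-toℕ a = toℕ-injective (trans (toℕ-ι _) (m<n⇒m%n≡m (toℕ<n a)))

  ι-+ : ∀ m n → ι m +F ι n ≡ ι (m ℕ.+ n)
  ι-+ m n = ι-cong-% (trans (cong (_% p) (cong₂ ℕ._+_ (toℕ-ι m) (toℕ-ι n))) (sym (%-distribˡ-+ m n p)))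

  ι-* : ∀ m n → ι m *F ι n ≡ ι (m ℕ.* n)
  ι-* m n = ι-cong-% (trans (cong (_% p) (cong₂ ℕ._*_ (toℕ-ι m) (toℕ-ι n))) (sym (%-distribˡ-* m n p)))

  1F : F p
  1F = ι 1

  -- Every residue is the image of its representative, so the ring axioms of F p follow from those
  -- of ℕ along the homomorphism `ι`.
  ι-elim : ∀ {P : F p → Set} → (∀ n → P (ι n)) → ∀ a → P a
  ι-elim {P} f a = subst P (ι-toℕ a) (f (toℕ a))

  +F-comm : ∀ a b → a +F b ≡ b +F a
  +F-comm a b = cong ι (ℕ.+-comm (toℕ a) (toℕ b))

  *F-comm : ∀ a b → a *F b ≡ b *F a
  *F-comm a b = cong ι (ℕ.*-comm (toℕ a) (toℕ b))

  +F-assoc : ∀ a b c → (a +F b) +F c ≡ a +F (b +F c)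
  +F-assoc = ι-elim λ k → ι-elim λ m → ι-elim λ n →
    trans (cong (_+F ι n) (ι-+ k m)) (trans (ι-+ (k ℕ.+ m) n) (trans (cong ι (ℕ.+-assoc k m n))
      (trans (sym (ι-+ k (m ℕ.+ n))) (cong (ι k +F_) (sym (ι-+ m n))))))

  *F-assoc : ∀ a b c → (a *F b) *F c ≡ a *F (b *F c)
  *F-assoc = ι-elim λ k → ι-elim λ m → ι-elim λ n →
    trans (cong (_*F ι n) (ι-* k m)) (trans (ι-* (k ℕ.* m) n) (trans (cong ι (ℕ.*-assoc k m n))
      (trans (sym (ι-* k (m ℕ.* n))) (cong (ι k *F_) (sym (ι-* m n))))))

  +F-identityˡ : ∀ a → 0F +F a ≡ a
  +F-identityˡ = ι-elim λ n → ι-+ 0 n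

  *F-identityˡ : ∀ a → 1F *F a ≡ a
  *F-identityˡ = ι-elim λ n → trans (ι-* 1 n) (cong ι (ℕ.+-identityʳ n))

  -F-inverseˡ : ∀ a → (-F a) +F a ≡ 0F
  -F-inverseˡ a = begin
    (-F a) +F a                   ≡⟨ cong ((-F a) +F_) (ι-toℕ a) ⟨
    ι (p ℕ.∸ toℕ a) +F ι (toℕ a)  ≡⟨ ι-+ _ _ ⟩
    ι (p ℕ.∸ toℕ a ℕ.+ toℕ a)     ≡⟨ cong ι (ℕ.m∸n+n≡m (ℕ.<⇒≤ (toℕ<n a))) ⟩
    ι p
      ≡⟨ ι-cong-% {p} {0} (trans (n%n≡0 p) (sym (m<n⇒m%n≡m (ℕ.>-nonZero⁻¹ p)))) ⟩
    0F                               ∎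
    where open ≡-Reasoning

  *F-distribʳ : ∀ c a b → (a +F b) *F c ≡ (a *F c) +F (b *F c)
  *F-distribʳ = ι-elim λ k → ι-elim λ m → ι-elim λ n →
    trans (cong (_*F ι k) (ι-+ m n)) (trans (ι-* (m ℕ.+ n) k) (trans (cong ι (ℕ.*-distribʳ-+ k m n))
      (trans (sym (ι-+ (m ℕ.* k) (n ℕ.* k))) (cong₂ _+F_ (sym (ι-* m k)) (sym (ι-* n k))))))

  commutativeRing : CommutativeRing _ _
  commutativeRing = record
    { Carrier = F p
    ; _≈_ = _≡_
    ; _+_ = _+F_
    ; _*_ = _*F_
    ; -_  = -F_
    ; 0#  = 0F
    ; 1#  = 1F
    ; isCommutativeRing = record
      { isRing = record
        { +-isAbelianGroup = record
          { isGroup = record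
            { isMonoid = record
              { isSemigroup = record
                { isMagma = record { isEquivalence = ≡.isEquivalence ; ∙-cong = cong₂ _+F_ }
                ; assoc = +F-assoc }
              ; identity = +F-identityˡ , λ a → trans (+F-comm a 0F) (+F-identityˡ a) }
            ; inverse = -F-inverseˡ , λ a → trans (+F-comm a (-F a)) (-F-inverseˡ a)
            ; ⁻¹-cong = cong -F_ }
          ; comm = +F-comm }
        ; *-cong = cong₂ _*F_
        ; *-assoc = *F-assoc
        ; *-identity = *F-identityˡ , λ a → trans (*F-comm a 1F) (*F-identityˡ a)
        ; distrib = (λ c a b → trans (*F-comm c (a +F b)) (trans (*F-distribʳ c a b) (cong₂ _+F_ (*F-comm a c) (*F-comm b c))))
                  , *F-distribʳ }
      ; *-comm = *F-comm } }

  open CommutativeRing commutativeRing using (zeroˡ; zeroʳ; *-identityʳ; +-identityʳ; +-abelianGroup; commutativeSemiring; ring)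
  open import Algebra.Solver.Ring.NaturalCoefficients.Default commutativeSemiring
    using (solve; _:=_; _:+_; _:*_) public
  open import Algebra.Properties.Ring ring using (-‿distribˡ-*; -‿+-comm)
  open import Algebra.Properties.AbelianGroup +-abelianGroup using (xyx⁻¹≈y; //-rightDividesˡ; //-rightDividesʳ)

  +F-cancelʳ : ∀ a b → (a +F b) +F (-F b) ≡ a
  +F-cancelʳ a b = //-rightDividesʳ b a

  -F-cancelʳ : ∀ a b → (a +F (-F b)) +F b ≡ a
  -F-cancelʳ a b = //-rightDividesˡ b a

  -- Bézout over ℕ comes in two forms: 1 + xp = yn makes y the inverse of n, and 1 + yn = xp makes
  -- it -y.
  inverse-ι : ∀ n → .{{NonZero n}} → n < p → ∃ λ b → b *F ι n ≡ 1F
  inverse-ι n n<p with coprime-Bézout (prime⇒coprime pr n<p)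
  ... | Bézout.-+ x y 1+xp≡yn = ι y , (begin
    ι y *F ι n         ≡⟨ ι-* y n ⟩
    ι (y ℕ.* n)        ≡⟨ cong ι 1+xp≡yn ⟨
    ι (1 ℕ.+ x ℕ.* p)  ≡⟨ ι-cong-% ([m+kn]%n≡m%n 1 x p) ⟩
    1F                 ∎)
    where open ≡-Reasoning
  ... | Bézout.+- x y 1+yn≡xp = -F (ι y) , (begin
    (-F ι y) *F ι n        ≡⟨ -‿distribˡ-* (ι y) (ι n) ⟨
    -F yn                  ≡⟨ +-identityʳ _ ⟨
    (-F yn) +F 0F          ≡⟨ cong ((-F yn) +F_) sum≡0 ⟨
    (-F yn) +F (1F +F yn)  ≡⟨ trans (+F-comm (-F yn) (1F +F yn)) (+F-cancelʳ 1F yn) ⟩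
    1F                     ∎)
    where
    open ≡-Reasoning
    yn = ι y *F ι n
    sum≡0 : 1F +F yn ≡ 0F
    sum≡0 = begin
      1F +F yn           ≡⟨ cong (1F +F_) (ι-* y n) ⟩
      1F +F ι (y ℕ.* n)  ≡⟨ ι-+ 1 (y ℕ.* n) ⟩
      ι (1 ℕ.+ y ℕ.* n)  ≡⟨ cong ι 1+yn≡xp ⟩
      ι (x ℕ.* p)        ≡⟨ ι-cong-% {x ℕ.* p} {0} ([m+kn]%n≡m%n 0 x p) ⟩
      0F                 ∎

  toℕ-nonZero : ∀ {a} → a ≢ 0F → NonZero (toℕ a)
  toℕ-nonZero {a} a≢0 = ℕ.≢-nonZero λ eq → a≢0 (trans (sym (ι-toℕ a)) (cong ι eq))

  inverse : ∀ a → a ≢ 0F → ∃ λ b → b *F a ≡ 1F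
  inverse a a≢0 with inverse-ι (toℕ a) {{toℕ-nonZero a≢0}} (toℕ<n a)
  ... | b , eq = b , trans (cong (b *F_) (sym (ι-toℕ a))) eq

  -V-comm : ∀ {d} (x y z : V d) → (x -V y) -V z ≡ (x -V z) -V y
  -V-comm []      []      []      = refl
  -V-comm (a ∷ x) (b ∷ y) (c ∷ z) = cong₂ _∷_
    (solve 3 (λ a b c → (a :+ b) :+ c := (a :+ c) :+ b) refl a (-F b) (-F c)) (-V-comm x y z)

  -V-involutive : ∀ {d} (x y : V d) → x -V (x -V y) ≡ y
  -V-involutive []      []      = refl
  -V-involutive (a ∷ x) (b ∷ y) = cong₂ _∷_
    (trans (cong (_+F (-F (a +F (-F b)))) (sym (-F-cancelʳ a b))) (xyx⁻¹≈y (a +F (-F b)) b)) (-V-involutive x y)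

  x+y-y≡x : ∀ {d} (x y : V d) → (x +V y) -V y ≡ x
  x+y-y≡x []      []      = refl
  x+y-y≡x (a ∷ x) (b ∷ y) = cong₂ _∷_
    (+F-cancelʳ a b) (x+y-y≡x x y)

  x-y+y≡x : ∀ {d} (x y : V d) → (x -V y) +V y ≡ x
  x-y+y≡x []      []      = refl
  x-y+y≡x (a ∷ x) (b ∷ y) = cong₂ _∷_
    (-F-cancelʳ a b) (x-y+y≡x x y)

  x-0≡x : ∀ {d} (x l : V d) → x -V (0F ·V l) ≡ x
  x-0≡x []      []      = refl
  x-0≡x (a ∷ x) (l ∷ ls) = cong₂ _∷_ (trans (cong (λ z → a +F (-F z)) (zeroˡ l)) lemma) (x-0≡x x ls)
    where
    lemma : a +F (-F 0F) ≡ a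
    lemma = trans (cong (a +F_) (trans (sym (+-identityʳ (-F 0F))) (-F-inverseˡ 0F))) (+-identityʳ a)

  x-[1+n]l : ∀ {d} n (x l : V d) → x -V (ι (suc n) ·V l) ≡ (x -V (ι n ·V l)) -V l
  x-[1+n]l n []      []      = refl
  x-[1+n]l n (a ∷ x) (l ∷ ls) = cong₂ _∷_
    (trans (cong (λ c → a +F (-F (c *F l))) (sym (ι-+ 1 n)))
      (trans (cong (λ c → a +F (-F c)) (trans (*F-distribʳ l 1F (ι n)) (cong (_+F (ι n *F l)) (*F-identityˡ l))))
        (trans (cong (a +F_) (sym (-‿+-comm l (ι n *F l))))
          (solve 3 (λ a l m → a :+ (l :+ m) := (a :+ m) :+ l) refl a (-F l) (-F (ι n *F l))))))
    (x-[1+n]l n x ls)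

  ι-*V : ∀ {d} m n (l : V d) → ι (m ℕ.* n) ·V l ≡ ι n ·V (ι m ·V l)
  ι-*V m n []       = refl
  ι-*V m n (l ∷ ls) = cong₂ _∷_
    (trans (cong (_*F l) (trans (cong ι (ℕ.*-comm m n)) (sym (ι-* n m)))) (*F-assoc (ι n) (ι m) l)) (ι-*V m n ls)

  1·V : ∀ {d} (l : V d) → 1F ·V l ≡ l
  1·V []       = refl
  1·V (l ∷ ls) = cong₂ _∷_ (*F-identityˡ l) (1·V ls)

  0·V : ∀ {d} (l : V d) → 0F ·V l ≡ 0V
  0·V []       = refl
  0·V (l ∷ ls) = cong₂ _∷_ (zeroˡ l) (0·V ls)

  +V-identityˡ : ∀ {d} (x : V d) → 0V +V x ≡ x
  +V-identityˡ []      = refl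
  +V-identityˡ (a ∷ x) = cong₂ _∷_ (+F-identityˡ a) (+V-identityˡ x)

  unit : ∀ {d} → Fin d → V d
  unit zero    = 1F ∷ 0V
  unit (suc i) = 0F ∷ unit i

  lincomb-unit : ∀ {d} (c : V d) → lincomb c unit ≡ c
  lincomb-unit []              = refl
  lincomb-unit {suc d} (a ∷ c) = begin
    (a ·V unit zero) +V foldr step 0V (List.tabulate suc)
      ≡⟨ cong (λ l → (a ·V unit zero) +V foldr step 0V l) (sym (map-tabulate id suc)) ⟩
    (a ·V unit zero) +V foldr step 0V (List.map suc (allFin d))
      ≡⟨ cong ((a ·V unit zero) +V_) (shift (allFin d)) ⟩
    (a ·V unit zero) +V (0F ∷ lincomb c unit)
      ≡⟨ cong₂ _∷_ (trans (+-identityʳ _) (*-identityʳ a))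
          (trans (cong (_+V lincomb c unit) (·0 d)) (trans (+V-identityˡ _) (lincomb-unit c))) ⟩
    a ∷ c ∎
    where
    open ≡-Reasoning
    step : Fin (suc d) → V (suc d) → V (suc d)
    step i acc = (lookup (a ∷ c) i ·V unit i) +V acc

    ·0 : ∀ d → a ·V 0V {d} ≡ 0V
    ·0 zero    = refl
    ·0 (suc d) = cong₂ _∷_ (zeroʳ a) (·0 d)

    -- The vectors `unit (suc i)` have leading coordinate 0, so the fold over them takes place in
    -- the remaining coordinates.
    shift : ∀ is → foldr step 0V (List.map suc is) ≡ 0F ∷ foldr (λ i acc → (lookup c i ·V unit i) +V acc) 0V is
    shift []       = refl
    shift (i ∷ is) = trans (cong (step (suc i)) (shift is))
      (cong (λ z → z ∷ ((lookup c i ·V unit i) +V foldr _ 0V is)) (trans (+-identityʳ _) (zeroʳ (lookup c i))))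

  -- A linear isomorphism `φ` stands in for the basis: the basis vectors are the images of the unit
  -- vectors, and forming linear combinations of them is `φ` itself. Matching `st` with `refl`
  -- removes the transport in `IsGraph`.
  graph-of-linear : ∀ {s t d} (st : s ℕ.+ t ≡ d) (φ : V (s ℕ.+ t) → V d) (φ⁻¹ : V d → V (s ℕ.+ t)) →
                    φ⁻¹ ∘ φ ≗ id → φ ∘ φ⁻¹ ≗ id →
                    (∀ x y → φ (x +V y) ≡ φ x +V φ y) → (∀ c x → φ (c ·V x) ≡ c ·V φ x) →
                    (f : V s → V t) (E : Subset d) →
                    (∀ y → (y ∈ E) ⇔ (∃ λ x → φ (x ++ f x) ≡ y)) → IsGraph E
  graph-of-linear {s} {t} refl φ φ⁻¹ φ⁻¹φ φφ⁻¹ φ-+ φ-· f E iff =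
    s , t , refl , e
    , ((λ c eq → trans (sym (φ⁻¹φ c)) (trans (cong φ⁻¹ (trans (sym (lincomb-e c)) (trans eq (sym φ-0)))) (φ⁻¹φ 0V)))
      , λ y → φ⁻¹ y , trans (lincomb-e _) (φφ⁻¹ y))
    , f
    , λ y → mk⇔ (λ y∈E → let (x , eq) = Equivalence.to (iff y) y∈E in x , trans (lincomb-e _) eq)
                (λ (x , eq) → Equivalence.from (iff y) (x , trans (sym (lincomb-e _)) eq))
    where
    e : Fin (s ℕ.+ t) → V (s ℕ.+ t)
    e i = φ (unit i)

    φ-0 : φ 0V ≡ 0V
    φ-0 = trans (cong φ (sym (0·V 0V))) (trans (φ-· 0F 0V) (0·V _))

    lincomb-e : ∀ c → lincomb c e ≡ φ c
    lincomb-e c = trans (go (allFin (s ℕ.+ t))) (cong φ (lincomb-unit c))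
      where
      go : ∀ is → foldr (λ i acc → (lookup c i ·V e i) +V acc) 0V is ≡
                  φ (foldr (λ i acc → (lookup c i ·V unit i) +V acc) 0V is)
      go []       = sym φ-0
      go (i ∷ is) = trans (cong₂ _+V_ (sym (φ-· (lookup c i) (unit i))) (go is)) (sym (φ-+ _ _))

  -- ψ x c runs through the line in direction v over the point x of the hyperplane yᵢ = 0.
  module Shear {n} (v : V (suc n)) (i : Fin (suc n)) (v≢0 : lookup v i ≢ 0F) where

    w : F p
    w = proj₁ (inverse (lookup v i) v≢0)

    wv≡1 : w *F lookup v i ≡ 1F
    wv≡1 = proj₂ (inverse (lookup v i) v≢0)

    ψ : V n → F p → V (suc n)
    ψ x c = insertAt x i 0F +V (c ·V v)

    -- The inserted coordinate is 0, so coordinate `i` of `ψ x c` is `c` times that of `v`;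
    -- multiplying by `w` recovers `c`.
    height : V (suc n) → F p
    height y = lookup y i *F w

    base : V (suc n) → V n
    base y = removeAt (y -V (height y ·V v)) i

    height-ψ : ∀ x c → height (ψ x c) ≡ c
    height-ψ x c = begin
      lookup (ψ x c) i *F w
        ≡⟨ cong (_*F w) (lookup-zipWith _+F_ i (insertAt x i 0F) (c ·V v)) ⟩
      (lookup (insertAt x i 0F) i +F lookup (c ·V v) i) *F w
        ≡⟨ cong (_*F w) (cong₂ _+F_ (insertAt-lookup x i 0F) (lookup-map i (c *F_) v)) ⟩
      (0F +F (c *F lookup v i)) *F w                         ≡⟨ cong (_*F w) (+F-identityˡ _) ⟩
      (c *F lookup v i) *F w
        ≡⟨ solve 3 (λ a b c → (a :* b) :* c := a :* (c :* b)) refl c (lookup v i) w ⟩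
      c *F (w *F lookup v i)  ≡⟨ cong (c *F_) wv≡1 ⟩
      c *F 1F                 ≡⟨ *-identityʳ c ⟩
      c                       ∎
      where open ≡-Reasoning

    base-ψ : ∀ x c → base (ψ x c) ≡ x
    base-ψ x c = trans (cong (λ z → removeAt (ψ x c -V (z ·V v)) i) (height-ψ x c))
      (trans (cong (λ z → removeAt z i) (x+y-y≡x (insertAt x i 0F) (c ·V v))) (removeAt-insertAt x i 0F))

    ψ-base-height : ∀ y → ψ (base y) (height y) ≡ y
    ψ-base-height y = trans
      (cong (_+V (height y ·V v)) (trans (cong (insertAt (removeAt z i) i) (sym z-i)) (insertAt-removeAt z i)))
      (x-y+y≡x y (height y ·V v))
      where
      open ≡-Reasoning
      z = y -V (height y ·V v)
      z-i : lookup z i ≡ 0F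
      z-i = begin
        lookup z i                                          ≡⟨ lookup-zipWith _ i y (height y ·V v) ⟩
        lookup y i +F (-F lookup (height y ·V v) i)
          ≡⟨ cong (λ u → lookup y i +F (-F u)) (lookup-map i (height y *F_) v) ⟩
        lookup y i +F (-F ((lookup y i *F w) *F lookup v i))
          ≡⟨ cong (λ u → lookup y i +F (-F u))
            (trans (*F-assoc (lookup y i) w (lookup v i)) (trans (cong (lookup y i *F_) wv≡1) (*-identityʳ (lookup y i)))) ⟩
        lookup y i +F (-F lookup y i)
          ≡⟨ trans (+F-comm (lookup y i) _) (-F-inverseˡ (lookup y i)) ⟩
        0F                                                  ∎

    insertAt-+ : ∀ {m} (x y : V m) (j : Fin (suc m)) → insertAt (x +V y) j 0F ≡ insertAt x j 0F +V insertAt y j 0F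
    insertAt-+ x       y       zero    = cong (_∷ (x +V y)) (sym (+F-identityˡ 0F))
    insertAt-+ (a ∷ x) (b ∷ y) (suc j) = cong (_ ∷_) (insertAt-+ x y j)

    insertAt-· : ∀ {m} c (x : V m) (j : Fin (suc m)) → insertAt (c ·V x) j 0F ≡ c ·V insertAt x j 0F
    insertAt-· c x       zero    = cong (_∷ (c ·V x)) (sym (zeroʳ c))
    insertAt-· c (a ∷ x) (suc j) = cong (_ ∷_) (insertAt-· c x j)

    +V-·V-interchange : ∀ {m} (x y u : V m) a b → (x +V y) +V ((a +F b) ·V u) ≡ (x +V (a ·V u)) +V (y +V (b ·V u))
    +V-·V-interchange []      []      []      a b = refl
    +V-·V-interchange (x ∷ xs) (y ∷ ys) (u ∷ us) a b = cong₂ _∷_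
      (solve 5 (λ x y u a b → (x :+ y) :+ ((a :+ b) :* u) := (x :+ (a :* u)) :+ (y :+ (b :* u))) refl x y u a b)
      (+V-·V-interchange xs ys us a b)

    ·V-distribˡ-+V : ∀ {m} (x u : V m) c a → (c ·V x) +V ((c *F a) ·V u) ≡ c ·V (x +V (a ·V u))
    ·V-distribˡ-+V []       []       c a = refl
    ·V-distribˡ-+V (x ∷ xs) (u ∷ us) c a = cong₂ _∷_
      (solve 4 (λ x u c a → (c :* x) :+ ((c :* a) :* u) := c :* (x :+ (a :* u))) refl x u c a)
      (·V-distribˡ-+V xs us c a)

    ψ-+ : ∀ x y a b → ψ (x +V y) (a +F b) ≡ ψ x a +V ψ y b
    ψ-+ x y a b = trans (cong (_+V ((a +F b) ·V v)) (insertAt-+ x y i)) (+V-·V-interchange _ _ v a b)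

    ψ-· : ∀ c x a → ψ (c ·V x) (c *F a) ≡ c ·V ψ x a
    ψ-· c x a = trans (cong (_+V ((c *F a) ·V v)) (insertAt-· c x i)) (·V-distribˡ-+V _ v c a)

    -- Here s = n and t = 1: the first n basis vectors are the standard ones spanning the
    -- hyperplane, and the last is `v`. `IsGraph` puts the free coordinates first, hence the detour
    -- through V (n + 1) with `take` and `drop`.
    graph-of-section : (f : V n → F p) (A : Subset (suc n)) →
                       (∀ x → ψ x (f x) ∈ A) → (∀ x c → ψ x c ∈ A → c ≡ f x) → IsGraph A
    graph-of-section f A on only = graph-of-linear (ℕ.+-comm n 1) φ φ⁻¹ φ⁻¹φ
      (λ y → trans (φ-++ (base y) (height y)) (ψ-base-height y)) φ-+ φ-· (λ x → f x ∷ []) A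
      λ y → mk⇔
        (λ y∈A → base y , trans (φ-++ (base y) _)
          (trans (cong (ψ (base y)) (sym (only (base y) (height y) (subst (_∈ A) (sym (ψ-base-height y)) y∈A))))
            (ψ-base-height y)))
        (λ (x , eq) → subst (_∈ A) (trans (sym (φ-++ x (f x))) eq) (on x))
      where
      φ : V (n ℕ.+ 1) → V (suc n)
      φ y = ψ (take n y) (head (drop n y))

      φ⁻¹ : V (suc n) → V (n ℕ.+ 1)
      φ⁻¹ y = base y ++ (height y ∷ [])

      φ-++ : ∀ x c → φ (x ++ (c ∷ [])) ≡ ψ x c
      φ-++ x c = cong₂ ψ (take-++ x) (cong head (drop-++ x))
        where
        take-++ : ∀ {m} (x : V m) → take m (x ++ (c ∷ [])) ≡ x
        take-++ []      = refl
        take-++ (a ∷ x) = cong (a ∷_) (take-++ x)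
        drop-++ : ∀ {m} (x : V m) → drop m (x ++ (c ∷ [])) ≡ c ∷ []
        drop-++ []      = refl
        drop-++ (a ∷ x) = drop-++ x

      singleton-head : (u : V 1) → head u ∷ [] ≡ u
      singleton-head (a ∷ []) = refl

      φ⁻¹φ : ∀ y → φ⁻¹ (φ y) ≡ y
      φ⁻¹φ y = trans (cong₂ (λ a b → a ++ (b ∷ [])) (base-ψ (take n y) (head (drop n y))) (height-ψ (take n y) (head (drop n y))))
        (trans (cong (take n y ++_) (singleton-head (drop n y))) (take++drop≡id n y))

      head-+ : (u u′ : V 1) → head (u +V u′) ≡ head u +F head u′
      head-+ (_ ∷ []) (_ ∷ []) = refl

      head-· : ∀ c (u : V 1) → head (c ·V u) ≡ c *F head u
      head-· c (_ ∷ []) = refl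

      φ-+ : ∀ x y → φ (x +V y) ≡ φ x +V φ y
      φ-+ x y = trans
        (cong₂ ψ (take-zipWith {m = n} _+F_ x y)
          (trans (cong head (drop-zipWith {m = n} _+F_ x y)) (head-+ (drop n x) (drop n y))))
        (ψ-+ (take n x) (take n y) (head (drop n x)) (head (drop n y)))

      φ-· : ∀ c x → φ (c ·V x) ≡ c ·V φ x
      φ-· c x = trans
        (cong₂ ψ (take-map (c *F_) n x) (trans (cong head (drop-map (c *F_) n x)) (head-· c (drop n x))))
        (ψ-· c (take n x) (head (drop n x)))

-- Dilations of tilings

prime∤^ : ∀ {q m} → Prime q → ¬ q ∣ m → ∀ n → ¬ q ∣ m ^ n
prime∤^ pr q∤m zero    q∣1 = ¬prime[1] (subst Prime (∣1⇒≡1 q∣1) pr)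
prime∤^ {m = m} pr q∤m (suc n) q∣ with euclidsLemma m (m ^ n) pr q∣
... | inj₁ q∣m = q∤m q∣m
... | inj₂ q∣^ = prime∤^ pr q∤m n q∣^

-- Sums over the whole space

module Enumeration (p : ℕ) (pr : Prime p) where
  open PrimeField p pr
  open Field p {{prime⇒nonZero pr}}

  cartesian : ∀ n → allVecs (suc n) ≡ cartesianProductWith _∷_ (allFin p) (allVecs n)
  cartesian n = go (allFin p)
    where
    go : ∀ as → concatMap (λ a → map (a ∷_) (allVecs n)) as ≡ cartesianProductWith _∷_ as (allVecs n)
    go []       = refl
    go (a ∷ as) = cong (map (a ∷_) (allVecs n) List.++_) (go as)

  allVecs-unique : ∀ n → Unique (allVecs n)
  allVecs-unique zero    = [] ∷ []
  allVecs-unique (suc n) = subst Unique (sym (cartesian n))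
    (cartesianProductWith⁺ _∷_ ∷-injective (allFin⁺ p) (allVecs-unique n))

  allVecs-complete : ∀ {n} (x : V n) → x ∈ˡ allVecs n
  allVecs-complete []      = here refl
  allVecs-complete (a ∷ x) = subst (a ∷ x ∈ˡ_) (sym (cartesian _))
    (∈-cartesianProductWith⁺ _∷_ (∈-allFin a) (allVecs-complete x))

  -- The first coordinate is summed innermost because `fibres` will use it as the height along a
  -- line.
  ∑-allVecs : ∀ n (g : V (suc n) → ℕ) → ∑ (allVecs (suc n)) g ≡ ∑ (allVecs n) (λ x → ∑ (allFin p) (λ a → g (a ∷ x)))
  ∑-allVecs n g = trans (∑-concatMap _ (allFin p) g)
    (trans (∑-cong (allFin p) (λ a → ∑-map (a ∷_) (allVecs n) g)) (∑-swap (allFin p) (allVecs n) _))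

  ∑-allVecs-1 : ∀ n → ∑ (allVecs n) (λ _ → 1) ≡ p ^ n
  ∑-allVecs-1 zero    = refl
  ∑-allVecs-1 (suc n) = begin
    ∑ (allVecs (suc n)) (λ _ → 1)                        ≡⟨ ∑-concatMap _ (allFin p) _ ⟩
    ∑ (allFin p) (λ a → ∑ (map (a ∷_) (allVecs n)) (λ _ → 1))
      ≡⟨ ∑-cong (allFin p) (λ a → trans (∑-map (a ∷_) (allVecs n) _) (∑-allVecs-1 n)) ⟩
    ∑ (allFin p) (λ _ → p ^ n)                           ≡⟨ ∑-const (allFin p) (p ^ n) ⟩
    length (allFin p) ℕ.* p ^ n
      ≡⟨ cong (ℕ._* p ^ n) (length-tabulate {n = p} id) ⟩
    p ^ suc n                                            ∎
    where open ≡-Reasoning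

  ∑-reindex : ∀ {n} (φ ψ : V n → V n) → ψ ∘ φ ≗ id → φ ∘ ψ ≗ id → ∀ g → ∑ (allVecs n) (g ∘ φ) ≡ ∑ (allVecs n) g
  ∑-reindex {n} = ∑-bijection (allVecs-unique n) allVecs-complete

-- Convolution operators, Frobenius and dilation

module Translations (p : ℕ) (pr : Prime p) (d : ℕ) where
  open PrimeField p pr
  open Enumeration p pr
  open Field p {{prime⇒nonZero pr}}
  open Operators (V d)
  open Semiring opSemiring using (_≈_) renaming (_+_ to _⊕_; _*_ to _⊛_)
  open import Algebra.Properties.Semiring.Exp opSemiring using (^-congˡ) renaming (_^_ to _^ᵒ_)
  open import Algebra.Properties.Semiring.Mult opSemiring using () renaming (_×_ to _×ᵒ_)

  τ : V d → Op
  τ l = record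
    { ap = λ g x → g (x -V l) ; ap-cong = λ eq x → eq (x -V l) ; ap-+ = λ _ _ _ → refl ; ap-0 = λ _ → refl }

  -- Convolution with the multiset L.
  S : List (V d) → Op
  S L = record
    { ap = λ g x → ∑ L (λ l → g (x -V l))
    ; ap-cong = λ eq x → ∑-cong L (λ l → eq (x -V l))
    ; ap-+ = λ g h x → ∑-+ L _ _
    ; ap-0 = λ x → trans (∑-const L 0) (ℕ.*-zeroʳ (length L)) }

  τ-S-comm : ∀ l L → τ l ⊛ S L ≈ S L ⊛ τ l
  τ-S-comm l L g x = ∑-cong L (λ m → cong g (-V-comm x l m))

  τ-^ : ∀ l n → τ l ^ᵒ n ≈ τ (ι n ·V l)
  τ-^ l zero    g x = cong g (sym (x-0≡x x l))
  τ-^ l (suc n) g x = trans (τ-^ l n g (x -V l)) (cong g (trans (-V-comm x l (ι n ·V l)) (sym (x-[1+n]l n x l))))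

  ap-× : ∀ n (U : Op) g x → ap (n ×ᵒ U) g x ≡ n ℕ.* ap U g x
  ap-× zero    U g x = refl
  ap-× (suc n) U g x = cong (ap U g x ℕ.+_) (ap-× n U g x)

  -- This is the Frobenius map of the group ring. Induction on `L` peels off one translation, which
  -- commutes with the rest, and the q-th power of translation by l is translation by ql.
  S-^-prime : ∀ {q} → Prime q → ∀ L g x → ∃ λ z → ap (S L ^ᵒ q) g x ≡ ap (S (map (ι q ·V_) L)) g x ℕ.+ q ℕ.* z
  S-^-prime {zero}  prq []      g x with () ← prime⇒nonZero prq
  -- The exponent is positive, so the power has an empty sum as a factor and vanishes.
  S-^-prime {suc n} prq []      g x = 0 , sym (ℕ.*-zeroʳ n)
  S-^-prime {q}     prq (l ∷ L) g x
    with Frobenius.freshman's-dream opSemiring prq (τ l) (S L) (τ-S-comm l L) | S-^-prime prq L g x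
  ... | u , binom | z , IH = z ℕ.+ ap u g x , (begin
    ap (S (l ∷ L) ^ᵒ q) g x
      ≡⟨ ^-congˡ q {S (l ∷ L)} {τ l ⊕ S L} (λ _ _ → refl) g x ⟩
    ap ((τ l ⊕ S L) ^ᵒ q) g x                                     ≡⟨ binom g x ⟩
    (ap (τ l ^ᵒ q) g x ℕ.+ ap (S L ^ᵒ q) g x) ℕ.+ ap (q ×ᵒ u) g x
      ≡⟨ cong₂ ℕ._+_ (cong₂ ℕ._+_ (τ-^ l q g x) IH) (ap-× q u g x) ⟩
    (a ℕ.+ (b ℕ.+ q ℕ.* z)) ℕ.+ q ℕ.* ap u g x  ≡⟨ regroup a b q z (ap u g x) ⟩
    (a ℕ.+ b) ℕ.+ q ℕ.* (z ℕ.+ ap u g x)        ∎)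
    where
    open ≡-Reasoning
    a = g (x -V (ι q ·V l))
    b = ap (S (map (ι q ·V_) L)) g x
    regroup : ∀ a b q z u → (a ℕ.+ (b ℕ.+ q ℕ.* z)) ℕ.+ q ℕ.* u ≡ (a ℕ.+ b) ℕ.+ q ℕ.* (z ℕ.+ u)
    regroup = solve-∀

  S-^-const : ∀ L n x → ap (S L ^ᵒ n) (λ _ → 1) x ≡ length L ^ n
  S-^-const L zero    x = refl
  S-^-const L (suc n) x = trans (∑-cong L (λ l → S-^-const L n (x -V l))) (∑-const L _)

  -- `^ᵒ` adds its new factor on the outside, whereas the tiling hypothesis evaluates the innermost
  -- factor, the one applied to `g`.
  ^-suc : ∀ U n g x → ap (U ^ᵒ suc n) g x ≡ ap (U ^ᵒ n) (ap U g) x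
  ^-suc U zero    g x = refl
  ^-suc U (suc n) g x = ap-cong U (^-suc U n g) x

  -- After exchanging the sums, each entry of `L` contributes a translate of `g`, which has the same
  -- total as `g`.
  mass : ∀ L g → ∑ (allVecs d) (ap (S L) g) ≡ length L ℕ.* ∑ (allVecs d) g
  mass L g = trans (∑-swap (allVecs d) L _)
    (trans (∑-cong L λ l → ∑-reindex (_-V l) (_+V l) (λ x → x-y+y≡x x l) (λ x → x+y-y≡x x l) g) (∑-const L _))

  -- A list serves as the first tile so that a dilate is just a `map` and visibly keeps its length;
  -- `g` will be the indicator of the other tile.
  Partition : List (V d) → (V d → ℕ) → Set
  Partition L g = ∀ x → ap (S L) g x ≡ 1

  partition-mass : ∀ L g → Partition L g → length L ℕ.* ∑ (allVecs d) g ≡ p ^ d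
  partition-mass L g tile = trans (sym (mass L g)) (trans (∑-cong (allVecs d) tile) (∑-allVecs-1 d))

  -- Modulo q, the q-th convolution power of L is its dilate qL (Frobenius), while S L ^ q maps g to
  -- the constant |L| ^ (q ∸ 1); hence qL covers every point, and exactly once since the masses agree.
  dilate-prime : ∀ {q} L g → Prime q → ¬ q ∣ length L → Partition L g → Partition (map (ι q ·V_) L) g
  dilate-prime {zero}  L g prq q∤ tile with () ← prime⇒nonZero prq
  dilate-prime {suc n} L g prq q∤ tile x = sym (∑-tight {xs = allVecs d} covered equal (allVecs-complete x))
    where
    qL = map (ι (suc n) ·V_) L

    power : ∀ x → ap (S L ^ᵒ suc n) g x ≡ length L ^ n
    power x = trans (^-suc (S L) n g x) (trans (ap-cong (S L ^ᵒ n) tile x) (S-^-const L n x))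

    covered : ∀ x → 1 ≤ ap (S qL) g x
    -- With q = suc n, an uncovered point would give |L|^n = q · z, but q is a prime not dividing
    -- |L|.
    covered x = ℕ.n≢0⇒n>0 λ none → let (z , eq) = S-^-prime prq L g x in
      prime∤^ prq q∤ n (divides z (trans (sym (power x))
        (trans eq (trans (cong (ℕ._+ suc n ℕ.* z) none) (ℕ.*-comm (suc n) z)))))

    equal : ∑ (allVecs d) (λ _ → 1) ≡ ∑ (allVecs d) (ap (S qL) g)
    equal = trans (∑-allVecs-1 d) (trans (sym (partition-mass L g tile))
      (trans (cong (ℕ._* ∑ (allVecs d) g) (sym (length-map (ι (suc n) ·V_) L))) (sym (mass qL g))))

  -- Dilating keeps the length of the list, so the hypothesis that the primes do not divide it
  -- survives for the remaining factors.
  dilate-product : ∀ L g qs → All Prime qs → All (λ q → ¬ q ∣ length L) qs → Partition L g →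
                   Partition (map (ι (product qs) ·V_) L) g
  dilate-product L g []       _          _        tile =
    subst (λ M → Partition M g) (sym (trans (map-cong 1·V L) (map-id L))) tile
  dilate-product L g (q ∷ qs) (pq ∷ pqs) (n ∷ ns) tile =
    subst (λ M → Partition M g)
      (trans (sym (map-∘ {g = ι (product qs) ·V_} {f = ι q ·V_} L)) (map-cong (λ l → sym (ι-*V q (product qs) l)) L))
      (dilate-product (map (ι q ·V_) L) g qs pqs (All.map (λ q∤ → q∤ ∘ subst (_ ∣_) (length-map (ι q ·V_) L)) ns)
        (dilate-prime L g pq n tile))

  -- The representative of `c` lies strictly between 0 and p, so its prime factors are below p and
  -- none of them divides |L| = p.
  dilate : ∀ L g → length L ≡ p → Partition L g → ∀ {c} → c ≢ 0F → Partition (map (c ·V_) L) g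
  dilate L g len tile {c} c≢0 =
    subst (λ k → Partition (map (k ·V_) L) g) (trans (cong ι (sym fac.isFactorisation)) (ι-toℕ c))
      (dilate-product L g fac.factors fac.factorsPrime coprime tile)
    where
    instance
      c≢0ℕ : NonZero (toℕ c)
      c≢0ℕ = toℕ-nonZero c≢0
    module fac = PrimeFactorisation (factorise (toℕ c))

    prime≢ : ∀ {q} → Prime q → q ∣ toℕ c → ¬ q ∣ length L
    prime≢ prq q∣c q∣len with prime⇒irreducible pr (subst (_ ∣_) len q∣len)
    ... | inj₁ refl = ¬prime[1] prq
    ... | inj₂ refl = ℕ.<⇒≱ (toℕ<n c) (∣⇒≤ q∣c)

    coprime : All (λ q → ¬ q ∣ length L) fac.factors
    coprime = All.tabulate λ q∈ → prime≢ (All.lookup fac.factorsPrime q∈)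
      (subst (_ ∣_) (sym fac.isFactorisation) (∈⇒∣product q∈))

-- Graphs

-- Euclid's lemma finds a factor p in `m` or in `n`; cancelling it lowers `k` by one.
factor-prime-power : ∀ {p} → Prime p → ∀ k m n → m ℕ.* n ≡ p ^ k → ∃₂ λ i j → m ≡ p ^ i × n ≡ p ^ j × i ℕ.+ j ≡ k
factor-prime-power pr zero    m n eq = 0 , 0 , ℕ.m*n≡1⇒m≡1 m n eq , ℕ.m*n≡1⇒n≡1 m n eq , refl
factor-prime-power {p} pr (suc k) m n eq
  with euclidsLemma m n pr (subst (p ∣_) (sym eq) (m∣m*n (p ^ k)))
... | inj₁ (divides m′ refl)
  with factor-prime-power pr k m′ n (ℕ.*-cancelˡ-≡ _ _ p {{prime⇒nonZero pr}}
         (trans (sym (ℕ.*-assoc p m′ n)) (trans (cong (ℕ._* n) (ℕ.*-comm p m′)) eq)))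
...   | i , j , refl , n≡ , i+j = suc i , j , ℕ.*-comm (p ^ i) p , n≡ , cong suc i+j
factor-prime-power {p} pr (suc k) m n eq | inj₂ (divides n′ refl)
  with factor-prime-power pr k m n′ (ℕ.*-cancelʳ-≡ _ _ p {{prime⇒nonZero pr}}
         (trans (ℕ.*-assoc m n′ p) (trans eq (ℕ.*-comm p (p ^ k)))))
...   | i , j , m≡ , refl , i+j = i , suc j , m≡ , ℕ.*-comm (p ^ j) p , trans (ℕ.+-suc i j) (cong suc i+j)

two-distinct : ∀ {X : Set} {xs : List X} → Unique xs → 2 ≤ length xs → ∃₂ λ x y → x ∈ˡ xs × y ∈ˡ xs × x ≢ y
two-distinct {xs = _ ∷ []}    _                 (s≤s ())
two-distinct {xs = x ∷ y ∷ _} ((x≢y ∷ _) ∷ _) _ = x , y , here refl , there (here refl) , x≢y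

-- From tilings to graphs

module Tilings (p : ℕ) (pr : Prime p) where
  open PrimeField p pr
  open Enumeration p pr
  open Field p {{prime⇒nonZero pr}}

  module _ {d : ℕ} where
    open Translations p pr d

    elements : Subset d → List (V d)
    elements E = filter (λ x → T? (E x)) (allVecs d)

    -- The involution that sends a to x - a exchanges the roles of the two tiles.
    Tiles-sym : (E A : Subset d) → Tiles E A → Tiles A E
    Tiles-sym E A tile x = begin
      card (λ a → E a ∧ A (x -V a))                           ≡⟨ length-filter _ (allVecs d) ⟩
      ∑ (allVecs d) (λ a → ind (E a ∧ A (x -V a)))
        ≡⟨ ∑-cong (allVecs d) (λ a → cong ind (∧-comm (E a) _)) ⟩
      ∑ (allVecs d) (λ a → ind (A (x -V a) ∧ E a))
        ≡⟨ ∑-cong (allVecs d) (λ a → cong (λ b → ind (A (x -V a) ∧ E b)) (-V-involutive x a)) ⟨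
      ∑ (allVecs d) (λ a → ind (A (x -V a) ∧ E (x -V (x -V a))))
        ≡⟨ ∑-reindex (x -V_) (x -V_) (-V-involutive x) (-V-involutive x) (λ a → ind (A a ∧ E (x -V a))) ⟩
      ∑ (allVecs d) (λ a → ind (A a ∧ E (x -V a)))  ≡⟨ length-filter _ (allVecs d) ⟨
      card (λ a → A a ∧ E (x -V a))                 ≡⟨ tile x ⟩
      1                                             ∎
      where open ≡-Reasoning

    -- `Tiles E A` sums over A, but the sum has to run over E, the set that will be dilated; hence
    -- the passage through `Tiles-sym`.
    Tiles⇒Partition : (E A : Subset d) → Tiles E A → Partition (elements E) (ind ∘ A)
    Tiles⇒Partition E A tile x = begin
      ∑ (elements E) (λ l → ind (A (x -V l)))                 ≡⟨ ∑-filter E (allVecs d) _ ⟩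
      ∑ (allVecs d) (λ l → ind (E l) ℕ.* ind (A (x -V l)))
        ≡⟨ ∑-cong (allVecs d) (λ l → ind-∧ (E l) _) ⟨
      ∑ (allVecs d) (λ l → ind (E l ∧ A (x -V l)))  ≡⟨ length-filter _ (allVecs d) ⟨
      card (λ l → E l ∧ A (x -V l))                 ≡⟨ Tiles-sym E A tile x ⟩
      1                                             ∎
      where open ≡-Reasoning

    card-* : (E A : Subset d) → Tiles E A → card E ℕ.* card A ≡ p ^ d
    card-* E A tile = trans (cong (card E ℕ.*_) (length-filter A (allVecs d)))
      (partition-mass (elements E) (ind ∘ A) (Tiles⇒Partition E A tile))

    singleton-graph : (A : Subset d) → card A ≡ 1 → IsGraph A
    singleton-graph A one with elements A in eq
    singleton-graph A ()  | []
    singleton-graph A ()  | _ ∷ _ ∷ _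
    singleton-graph A one | a ∷ [] =
      graph-of-linear refl id id (λ _ → refl) (λ _ → refl) (λ _ _ → refl) (λ _ _ → refl) (λ _ → a) A
        λ y → mk⇔ (λ y∈A → [] , sym (only (subst (y ∈ˡ_) eq (∈-filter⁺ (λ x → T? (A x)) (allVecs-complete y) y∈A))))
                  (λ { ([] , refl) → proj₂ (∈-filter⁻ (λ x → T? (A x)) {xs = allVecs d} (subst (a ∈ˡ_) (sym eq) (here refl))) })
      where
      only : ∀ {y} → y ∈ˡ a ∷ [] → y ≡ a
      only (here y≡a) = y≡a

    -- A common value would be covered twice by the tiling cE ⊕ A, once through ce and once through
    -- ce′. The count runs over the elements of E with the dilation inside the summand, so e ≠ e′
    -- already separates the two terms.
    no-common-direction : (E A : Subset d) → Tiles E A → card E ≡ p →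
      ∀ {e e′ a a′ c} → e ∈ˡ elements E → e′ ∈ˡ elements E → e ≢ e′ → a ∈ A → a′ ∈ A → c ≢ 0F →
      a +V (c ·V e′) ≢ a′ +V (c ·V e)
    no-common-direction E A tile cardE {e} {e′} {a} {a′} {c} e∈ e′∈ e≢e′ a∈ a′∈ c≢0 eq = ℕ.<⇒≱ (ℕ.n<1+n 1) (begin
      2                                                           ≡⟨ cong₂ ℕ._+_ (ind≡1 a′∈) (ind≡1 a∈) ⟨
      ind (A a′) ℕ.+ ind (A a)
        ≡⟨ cong₂ (λ u v → ind (A u) ℕ.+ ind (A v))
          (trans (cong (_-V (c ·V e)) eq) (x+y-y≡x a′ (c ·V e))) (x+y-y≡x a (c ·V e′)) ⟨
      ind (A (x -V (c ·V e))) ℕ.+ ind (A (x -V (c ·V e′)))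
        ≤⟨ two-terms≤∑ (λ l → ind (A (x -V (c ·V l)))) e≢e′ e∈ e′∈ ⟩
      ∑ (elements E) (λ l → ind (A (x -V (c ·V l))))              ≡⟨ ∑-map (c ·V_) (elements E) _ ⟨
      ∑ (map (c ·V_) (elements E)) (λ l → ind (A (x -V l)))
        ≡⟨ dilate (elements E) (ind ∘ A) cardE (Tiles⇒Partition E A tile) c≢0 x ⟩
      1                                                           ∎)
      where
      open ℕ.≤-Reasoning
      x = a +V (c ·V e′)

  nonzero-coordinate : ∀ {d} (v : V d) → v ≢ 0V → ∃ λ i → lookup v i ≢ 0F
  nonzero-coordinate []      v≢0 = ⊥-elim (v≢0 refl)
  nonzero-coordinate (a ∷ v) v≢0 with a ≟ 0F
  ... | no a≢0   = zero , a≢0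
  ... | yes refl with nonzero-coordinate v (v≢0 ∘ cong (0F ∷_))
  ...   | i , vᵢ≢0 = suc i , vᵢ≢0

  module Transversal {n} (E A : Subset (suc n)) (tile : Tiles E A) (cardE : card E ≡ p)
                     {e e′ : V (suc n)} (e∈ : e ∈ˡ elements E) (e′∈ : e′ ∈ˡ elements E) (e≢e′ : e ≢ e′)
                     (i : Fin (suc n)) (vᵢ≢0 : lookup (e -V e′) i ≢ 0F) where
    v : V (suc n)
    v = e -V e′
    open Shear v i vᵢ≢0

    -- With v = e - e′ the bracket `v +V e′` is e, so two points on a line in direction `v` produce
    -- exactly the equation refuted by `no-common-direction`.
    collinear : ∀ {m} (u v e′ : V m) k c → (u +V ((k +F c) ·V v)) +V (k ·V e′) ≡ (u +V (c ·V v)) +V (k ·V (v +V e′))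
    collinear []      []      []       k c = refl
    collinear (u ∷ us) (v ∷ vs) (e ∷ es) k c = cong₂ _∷_
      (solve 5 (λ u v e k c → (u :+ ((k :+ c) :* v)) :+ (k :* e) := (u :+ (c :* v)) :+ (k :* (v :+ e))) refl u v e k c)
      (collinear us vs es k c)

    once : ∀ x {c c′} → c ≢ c′ → ψ x c ∈ A → ψ x c′ ∈ A → ⊥
    once x {c} {c′} c≢c′ c∈ c′∈ =
      no-common-direction E A tile cardE {c = k} e∈ e′∈ e≢e′ c∈ c′∈ k≢0 (begin
        ψ x c +V (k ·V e′)          ≡⟨ cong (λ z → ψ x z +V (k ·V e′)) (-F-cancelʳ c c′) ⟨
        ψ x (k +F c′) +V (k ·V e′)  ≡⟨ collinear (insertAt x i 0F) v e′ k c′ ⟩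
        ψ x c′ +V (k ·V (v +V e′))  ≡⟨ cong (λ z → ψ x c′ +V (k ·V z)) (x-y+y≡x e e′) ⟩
        ψ x c′ +V (k ·V e)          ∎)
      where
      open ≡-Reasoning
      -- The difference of the two heights is the factor by which E is dilated.
      k = c +F (-F c′)
      k≢0 : k ≢ 0F
      k≢0 k≡0 = c≢c′ (trans (sym (-F-cancelʳ c c′)) (trans (cong (_+F c′) k≡0) (+F-identityˡ c′)))

    fibre : V n → ℕ
    fibre x = ∑ (allFin p) (λ c → ind (A (ψ x c)))

    shear unshear : V (suc n) → V (suc n)
    shear (c ∷ x) = ψ x c
    unshear y = height y ∷ base y

    unshear-shear : ∀ y → unshear (shear y) ≡ y
    unshear-shear (c ∷ x) = cong₂ _∷_ (height-ψ x c) (base-ψ x c)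

    cardA : card A ≡ p ^ n
    cardA = ℕ.*-cancelˡ-≡ _ _ p (trans (cong (ℕ._* card A) (sym cardE)) (card-* E A tile))

    -- Shearing is a bijection of the space, so the points of A, counted line by line, number |A| =
    -- p^n, one for each line on average.
    fibres : ∑ (allVecs n) fibre ≡ ∑ (allVecs n) (λ _ → 1)
    fibres = begin
      ∑ (allVecs n) fibre                        ≡⟨ ∑-allVecs n (ind ∘ A ∘ shear) ⟨
      ∑ (allVecs (suc n)) (ind ∘ A ∘ shear)
        ≡⟨ ∑-reindex shear unshear unshear-shear ψ-base-height (ind ∘ A) ⟩
      ∑ (allVecs (suc n)) (ind ∘ A)  ≡⟨ length-filter A (allVecs (suc n)) ⟨
      card A                         ≡⟨ cardA ⟩
      p ^ n                          ≡⟨ ∑-allVecs-1 n ⟨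
      ∑ (allVecs n) (λ _ → 1)        ∎
      where open ≡-Reasoning

    -- No line carries more than one point and the average is one, so no line is empty.
    fibre≡1 : ∀ x → fibre x ≡ 1
    fibre≡1 x = ∑-tight {xs = allVecs n} (λ x → ∑-ind≤1 (λ c → A (ψ x c)) (allFin⁺ p) (once x)) fibres (allVecs-complete x)

    point : ∀ x → ∃ λ c → ψ x c ∈ A
    point x = ∑-ind>0 (allFin p) (λ c → A (ψ x c)) (ℕ.≤-reflexive (sym (fibre≡1 x)))

    only : ∀ x c → ψ x c ∈ A → c ≡ proj₁ (point x)
    only x c c∈ = decidable-stable (c ≟ proj₁ (point x)) λ neq → once x neq c∈ (proj₂ (point x))

    graph : IsGraph A
    graph = graph-of-section (proj₁ ∘ point) A (proj₂ ∘ point) only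

  prime-tile⇒graph : ∀ {n} (E A : Subset (suc n)) → Tiles E A → card E ≡ p → IsGraph A
  prime-tile⇒graph {n} E A tile cardE =
    let e , e′ , e∈ , e′∈ , e≢e′ = two-distinct {xs = elements E}
          (filter⁺ (λ x → T? (E x)) (allVecs-unique (suc n)))
          (subst (2 ≤_) (sym cardE) (ℕ.nonTrivial⇒n>1 p {{prime⇒nonTrivial pr}}))
        i , vᵢ≢0 = nonzero-coordinate (e -V e′)
          (λ v≡0 → e≢e′ (trans (sym (x-y+y≡x e e′)) (trans (cong (_+V e′) v≡0) (+V-identityˡ e′))))
    in Transversal.graph E A tile cardE e∈ e′∈ e≢e′ i vᵢ≢0

  tiling-graphical : ∀ {n} (E A : Subset (suc n)) → Tiles E A → card E ≡ p ⊎ card E ≡ p ^ n → IsGraph E ⊎ IsGraph A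
  tiling-graphical {n} E A tile (inj₁ cardE) = inj₂ (prime-tile⇒graph E A tile cardE)
  -- Cancelling |E| = p^n from |E||A| = p^(n+1) leaves |A| = p, so the prime case applies with the
  -- tiles exchanged.
  tiling-graphical {n} E A tile (inj₂ cardE) = inj₁ (prime-tile⇒graph A E (Tiles-sym E A tile)
    (ℕ.*-cancelˡ-≡ _ _ (p ^ n) {{ℕ.m^n≢0 p n}}
      (trans (cong (ℕ._* card A) (sym cardE)) (trans (card-* E A tile) (ℕ.*-comm p (p ^ n))))))

  -- Since |E||A| = p^3, the size of E is p^i with i at most 3. The exponents 1 and 2 are the sizes
  -- p and p^(d-1); the exponents 0 and 3 make E or A a singleton.
  tiling-graphical₃ : (E A : Subset 3) → Tiles E A → IsGraph E ⊎ IsGraph A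
  tiling-graphical₃ E A tile with factor-prime-power pr 3 (card E) (card A) (card-* E A tile)
  ... | 0 , _ , cardE , _ , _ = inj₁ (singleton-graph E cardE)
  ... | 1 , _ , cardE , _ , _ = tiling-graphical E A tile (inj₁ (trans cardE (ℕ.*-identityʳ p)))
  ... | 2 , _ , cardE , _ , _ = tiling-graphical E A tile (inj₂ cardE)
  ... | 3 , 0 , _ , cardA , _ = inj₂ (singleton-graph A cardA)
  ... | 3 , suc _ , _ , _ , ()
  ... | suc (suc (suc (suc _))) , _ , _ , _ , ()

mainTheorem4 : ((p : ℕ) (pr : Prime p) →
    let open Field p {{prime⇒nonZero pr}} in
    (E A : Subset 3) → Tiles E A → IsGraph E ⊎ IsGraph A)
    × ((p : ℕ) (pr : Prime p) (d : ℕ) → d ≥ 1 →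
    let open Field p {{prime⇒nonZero pr}} in
    (E A : Subset d) → Tiles E A →
    (card E ≡ p ⊎ card E ≡ p ^ (d ∸ 1)) → IsGraph E ⊎ IsGraph A)
mainTheorem4 = Tilings.tiling-graphical₃ , λ { p pr (suc n) _ → Tilings.tiling-graphical p pr }
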